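{- There is an absolute constant $C$ such that every connected interval graph $G$ with $n$ vertices satisfies $c_{\infty}(G) \le C\sqrt{n}$.
   Context: Cops and Robber game with a fast robber: played on a finite simple connected graph $G$. The cops first choose initial vertices (several may share a vertex), then the robber chooses a vertex. Players alternate rounds, cops first. Each cop stays or moves to an adjacent vertex; the robber may stay or move along any path from her current vertex containing no vertex occupied by a cop. The cops win if a cop moves onto the robber's vertex; the robber wins if she evades forever. $c_{\infty}(G)$ is the minimum number of cops guaranteeing a cop win. -}

module Defs where

open import Level using (0ℓ)
open import Data.Nat using (ℕ)
open import Data.Fin using (Fin)
open import Data.Product using (Σ; ∃; _×_)
open import Data.Sum using (_⊎_)
open import Data.Empty using (⊥)
open import Relation.Nullary using (¬_)
open import Relation.Binary.PropositionalEquality using (_≡_)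
open import Data.Rational using (ℚ) renaming (_≤_ to _≤ℚ_)

record Graph (n : ℕ) : Set₁ where
  field
    Adj     : Fin n → Fin n → Set
    sym     : ∀ {u v} → Adj u v → Adj v u
    irrefl  : ∀ {u} → ¬ Adj u u
open Graph public

data Walk {n : ℕ} (G : Graph n) : Fin n → Fin n → Set where
  here : ∀ {u} → Walk G u u
  step : ∀ {u v w} → Walk G u v → Adj G v w → Walk G u w

Connected : {n : ℕ} → Graph n → Set
Connected {n} G = (u v : Fin n) → Walk G u v

IsInterval : {n : ℕ} → Graph n → Set
IsInterval {n} G =
  Σ (Fin n → ℚ) λ a → Σ (Fin n → ℚ) λ b →
    ((v : Fin n) → a v ≤ℚ b v) ×
    ((u v : Fin n) → ¬ (u ≡ v) →
       (Adj G u v → ∃ λ x → (a u ≤ℚ x × x ≤ℚ b u) × (a v ≤ℚ x × x ≤ℚ b v)) ×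
       ((∃ λ x → (a u ≤ℚ x × x ≤ℚ b u) × (a v ≤ℚ x × x ≤ℚ b v)) → Adj G u v))

Cops : ℕ → ℕ → Set
Cops n k = Fin k → Fin n

Occupied : {n k : ℕ} → Cops n k → Fin n → Set
Occupied c v = ∃ λ i → c i ≡ v

CopMove : {n k : ℕ} → Graph n → Cops n k → Cops n k → Set
CopMove G c c' = ∀ i → (c' i ≡ c i) ⊎ Adj G (c i) (c' i)

data RobberReach {n k : ℕ} (G : Graph n) (c : Cops n k) (r : Fin n) : Fin n → Set where
  stay : ¬ Occupied c r → RobberReach G c r r
  go   : ∀ {u w} → RobberReach G c r u → Adj G u w → ¬ Occupied c w →
         RobberReach G c r w

-- CopsWinFrom G c r : with cops at c, robber at r, and the cops to move,
-- the cops can force capture (in finitely many rounds).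
data CopsWinFrom {n k : ℕ} (G : Graph n) (c : Cops n k) (r : Fin n) : Set where
  capture : (c' : Cops n k) → CopMove G c c' → Occupied c' r → CopsWinFrom G c r
  move    : (c' : Cops n k) → CopMove G c c' →
            ((r' : Fin n) → RobberReach G c' r r' → CopsWinFrom G c' r') →
            CopsWinFrom G c r

CopWin : {n : ℕ} → Graph n → ℕ → Set
CopWin {n} G k = Σ (Cops n k) λ c₀ → (r : Fin n) → CopsWinFrom G c₀ r

{-# OPTIONS --safe #-}
-- Let p₀ be the leftmost left endpoint, let vᵢ reach furthest right among the
-- intervals starting at or before pᵢ, and let pᵢ₊₁ be the right endpoint of vᵢ.
-- The cuts Sᵢ = {v : a v ≤ pᵢ < b v} are pairwise disjoint, because v ∈ Sᵢ forces
-- b v ≤ pᵢ₊₁; hence among any s ≥ √n consecutive cuts one has at most s vertices.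
-- A cut occupied by cops confines the robber to {v : a v > pᵢ}, and cops on
-- vᵢ, …, vⱼ₋₁ are adjacent to every vertex starting between pᵢ and pⱼ.  While one
-- team of 2s cops holds a small cut, a second team occupies the next small cut and
-- the vᵢ in between; either the robber is caught or she is beyond the next cut, and
-- the two teams swap roles.  This uses 4s cops.
module Submission where

open import Defs
open import Data.Nat using (ℕ; zero; suc; _+_; _*_; _∸_; _≤_; _<_; z≤n; s≤s; _≤?_; _⊔_)
import Data.Nat.Properties as ℕ
open import Data.Nat.Tactic.RingSolver using (solve-∀)
open import Data.Fin using (Fin; zero; suc; combine; remQuot; _≟_)
open import Data.Fin.Properties using (remQuot-combine)
open import Data.List using (List; []; _∷_; _++_; length; filter; allFin)
open import Data.List.Properties using (length-++; length-filter; length-tabulate; filter-some)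
open import Data.List.Relation.Unary.Any as Any using (Any; here; there)
open import Data.List.Relation.Unary.Any.Properties using (++⁺ˡ; ++⁺ʳ)
open import Data.List.Relation.Unary.All as All using ()
open import Data.List.Relation.Unary.All.Properties using (all-filter)
open import Data.List.Membership.Propositional using (lose)
open import Data.List.Membership.Propositional.Properties using (∈-filter⁺; ∈-allFin)
open import Data.Product using (Σ; ∃; _×_; _,_; proj₁; proj₂; uncurry)
open import Data.Rational using (ℚ) renaming (_≤_ to _≤ℚ_; _<_ to _<ℚ_)
import Data.Rational.Properties as ℚ
open import Data.Sum using (_⊎_; inj₁; inj₂; map₁)
open import Function using (_∘_)
open import Relation.Binary.Bundles using (DecTotalOrder)
open import Relation.Binary.PropositionalEquality using (_≡_; refl; trans; cong; subst; subst₂) renaming (sym to ≡-sym)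
open import Relation.Nullary using (¬_; yes; no; contradiction)
open import Relation.Nullary.Decidable using (_×-dec_)
open import Relation.Unary using (Decidable)

open import Data.List.Extrema (DecTotalOrder.totalOrder ℚ.≤-decTotalOrder)
  using (argmin; argmax; argmax-all; f[argmin]≤f[xs]; f[xs]≤f[argmax])

-- Sweeping a graph with two teams of cops

Touches : ∀ {n} → Graph n → Fin n → Fin n → Set
Touches G u r = u ≡ r ⊎ Adj G u r

walkLength : ∀ {n} {G : Graph n} {u v} → Walk G u v → ℕ
walkLength here       = 0
walkLength (step w _) = suc (walkLength w)

fin-bounded : ∀ {k} (f : Fin k → ℕ) → ∃ λ L → ∀ i → f i ≤ L
fin-bounded {zero}  f = 0 , λ ()
fin-bounded {suc k} f with fin-bounded (f ∘ suc)
... | L , f≤L = f zero ⊔ L , λ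
  { zero    → ℕ.m≤m⊔n (f zero) L
  ; (suc i) → ℕ.≤-trans (f≤L i) (ℕ.m≤n⊔m (f zero) L) }

-- A `Walk` is extended at its end, so with the target as its source a cop advances by undoing the
-- last step. The final conjunct keeps a cop that has arrived in place, whatever walk it carries.
walk-advance : ∀ {n} {G : Graph n} L {t u} (w : Walk G t u) → walkLength w ≤ suc L →
  Σ (Fin n) λ u' → (u' ≡ u ⊎ Adj G u u') ×
    (Σ (Walk G t u') λ w' → walkLength w' ≤ L) × (u ≡ t → u' ≡ t)
walk-advance {G = G} L {t} {u} w w≤ with u ≟ t
... | yes refl = u , inj₁ refl , (here , z≤n) , λ _ → refl
... | no u≢t with w
...   | here                = contradiction refl u≢t
...   | step {v = v} w' v~u = v , inj₂ (sym G v~u) , (w' , ℕ.≤-pred w≤) , λ u≡t → contradiction u≡t u≢t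

capture-touched : ∀ {n k} {G : Graph n} {c : Cops n k} {r} i → Touches G (c i) r → CopsWinFrom G c r
capture-touched {n} {k} {G} {c} {r} i ci~r = capture c' moves (i , at-i)
  where
  c' : Cops n k
  c' j with j ≟ i
  ... | yes _ = r
  ... | no  _ = c j
  at-i : c' i ≡ r
  at-i with i ≟ i
  ... | yes _  = refl
  ... | no i≢i = contradiction refl i≢i
  moves : CopMove G c c'
  moves j with j ≟ i
  ... | no  _    = inj₁ refl
  ... | yes refl = map₁ ≡-sym ci~r

-- `X j` is the station of a team at stage `j`; `R j` is the region to which a team standing there
-- confines the robber.
module Sweep {n q} (G : Graph n) (connected : Connected G)
  (X : ℕ → Fin q → Fin n) (R : ℕ → Fin n → Set)
  (barrier  : ∀ j {u w} → R j u → Adj G u w → ¬ Occupied (X j) w → R j w)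
  (progress : ∀ j {r} → R j r → (∃ λ i → Touches G (X (suc j) i) r) ⊎ R (suc j) r)
  where

  Holds : Cops n (2 * q) → Fin 2 → ℕ → Set
  Holds c b j = ∀ i → c (combine b i) ≡ X j i

  other : Fin 2 → Fin 2
  other zero       = suc zero
  other (suc zero) = zero

  reach-confined : ∀ {c b j r r'} → Holds c b j → R j r → RobberReach G c r r' → R j r'
  reach-confined held Rr (stay _) = Rr
  reach-confined {b = b} {j} held Rr (go reach adj free) =
    barrier j (reach-confined {b = b} held Rr reach) adj
      λ { (i , Xi≡w) → free (combine b i , trans (held i) Xi≡w) }

  deployment : Fin 2 → ℕ → Fin 2 → Fin q → Fin n
  deployment zero       j zero       = X j
  deployment zero       j (suc zero) = X (suc j)
  deployment (suc zero) j zero       = X (suc j)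
  deployment (suc zero) j (suc zero) = X j

  target : Fin 2 → ℕ → Cops n (2 * q)
  target b j = uncurry (deployment b j) ∘ remQuot {2} q

  target-held : ∀ b j → Holds (target b j) b j
  target-held zero       j i = cong (uncurry (deployment zero j)) (remQuot-combine {2} zero i)
  target-held (suc zero) j i = cong (uncurry (deployment (suc zero) j)) (remQuot-combine {2} (suc zero) i)

  target-other : ∀ b j → Holds (target b j) (other b) (suc j)
  target-other zero       j i = cong (uncurry (deployment zero j)) (remQuot-combine {2} (suc zero) i)
  target-other (suc zero) j i = cong (uncurry (deployment (suc zero) j)) (remQuot-combine {2} zero i)

  -- Induction on a bound `L` for the walks left to the targets. The holding team stands on its
  -- targets and never moves, so the robber stays in `R j` until the other team has reached
  -- `X (suc j)`; then `progress` applies.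
  march : ∀ b j → (∀ {c r} → Holds c (other b) (suc j) → R (suc j) r → CopsWinFrom G c r) →
    ∀ L c {r} (w : ∀ i → Walk G (target b j i) (c i)) → (∀ i → walkLength (w i) ≤ L) →
    Holds c b j → R j r → CopsWinFrom G c r
  march b j continue zero c {r} w short held Rr = arrive (progress j Rr)
    where
    arrived : ∀ {t u} (w : Walk G t u) → walkLength w ≤ 0 → u ≡ t
    arrived here _ = refl
    held' : Holds c (other b) (suc j)
    held' i = trans (arrived (w _) (short _)) (target-other b j i)
    arrive : (∃ λ i → Touches G (X (suc j) i) r) ⊎ R (suc j) r → CopsWinFrom G c r
    arrive (inj₁ (i , X~r)) =
      capture-touched (combine (other b) i) (subst (λ u → Touches G u r) (≡-sym (held' i)) X~r)
    arrive (inj₂ Rr') = continue held' Rr'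
  march b j continue (suc L) c {r} w short held Rr =
    move c' (proj₁ ∘ proj₂ ∘ next) λ r' reach →
      march b j continue L c' (λ i → proj₁ (walks i)) (λ i → proj₂ (walks i)) held'
        (reach-confined {b = b} held' Rr reach)
    where
    next  = λ i → walk-advance L (w i) (short i)
    c'    = proj₁ ∘ next
    walks = λ i → proj₁ (proj₂ (proj₂ (next i)))
    held' : Holds c' b j
    held' i = trans (proj₂ (proj₂ (proj₂ (next (combine b i)))) (trans (held i) (≡-sym (target-held b j i))))
                (target-held b j i)

  -- Induction on the number `d` of stages left before the region `R m`, which is empty; the teams
  -- swap roles at each stage.
  holder-wins : ∀ {m} → (∀ r → ¬ R m r) → ∀ d j → d + j ≡ m →
    ∀ {b c r} → Holds c b j → R j r → CopsWinFrom G c r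
  holder-wins empty zero j refl {r = r} held Rr = contradiction Rr (empty r)
  holder-wins empty (suc d) j d+j≡m {b} {c} held Rr =
    march b j (holder-wins empty d (suc j) (trans (ℕ.+-suc d j) d+j≡m) {other b}) L c w w≤L held Rr
    where
    w   = λ i → connected (target b j i) (c i)
    L   = proj₁ (fin-bounded (walkLength ∘ w))
    w≤L = proj₂ (fin-bounded (walkLength ∘ w))

  sweep : (∀ r → (∃ λ i → Touches G (X 0 i) r) ⊎ R 0 r) → (∃ λ m → ∀ r → ¬ R m r) → CopWin G (2 * q)
  sweep start (m , empty) = c₀ , λ r → first (start r)
    where
    -- Both teams start on `X 0`, and team `zero` is the first to hold.
    c₀ : Cops n (2 * q)
    c₀ = X 0 ∘ proj₂ ∘ remQuot {2} q
    held₀ : Holds c₀ zero 0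
    held₀ i = cong (X 0 ∘ proj₂) (remQuot-combine {2} zero i)
    first : ∀ {r} → (∃ λ i → Touches G (X 0 i) r) ⊎ R 0 r → CopsWinFrom G c₀ r
    first {r} (inj₁ (i , X~r)) =
      capture-touched (combine {2} zero i) (subst (λ u → Touches G u r) (≡-sym (held₀ i)) X~r)
    first (inj₂ Rr) = holder-wins empty m 0 (ℕ.+-identityʳ m) {zero} held₀ Rr

-- Finite counting

-- A team has exactly `q` members, so spare cops stand on the default vertex.
pad : ∀ {A : Set} q → A → List A → Fin q → A
pad q       d []       i       = d
pad (suc q) d (x ∷ xs) zero    = x
pad (suc q) d (x ∷ xs) (suc i) = pad q d xs i

pad-any : ∀ {A : Set} {P : A → Set} q d {xs} → length xs ≤ q → Any P xs → ∃ λ i → P (pad q d xs i)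
pad-any (suc q) d le       (here px)   = zero , px
pad-any (suc q) d (s≤s le) (there pxs) with pad-any q d le pxs
... | i , p = suc i , p

length-filter-disjoint : ∀ {A : Set} {P Q R : A → Set} (P? : Decidable P) (Q? : Decidable Q) (R? : Decidable R) →
  (∀ {x} → P x → R x) → (∀ {x} → Q x → R x) → (∀ {x} → P x → ¬ Q x) →
  ∀ xs → length (filter P? xs) + length (filter Q? xs) ≤ length (filter R? xs)
length-filter-disjoint P? Q? R? P⊆R Q⊆R P∩Q=∅ [] = z≤n
length-filter-disjoint P? Q? R? P⊆R Q⊆R P∩Q=∅ (x ∷ xs)
  with ih ← length-filter-disjoint P? Q? R? P⊆R Q⊆R P∩Q=∅ xs | P? x | Q? x | R? x
... | yes p | yes q | _      = contradiction q (P∩Q=∅ p)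
... | yes p | no _  | no ¬r  = contradiction (P⊆R p) ¬r
... | no _  | yes q | no ¬r  = contradiction (Q⊆R q) ¬r
... | yes _ | no _  | yes _  = s≤s ih
... | no _  | yes _ | yes _  = ℕ.≤-trans (ℕ.≤-reflexive (ℕ.+-suc _ _)) (s≤s ih)
... | no _  | no _  | yes _  = ℕ.m≤n⇒m≤1+n ih
... | no _  | no _  | no _   = ih

-- If all `t` values of `σ` from `e` on exceed `k`, each raises `τ` by at least `suc k`.
small-increment-or-growth : (σ τ : ℕ → ℕ) → (∀ i → σ i + τ i ≤ τ (suc i)) → ∀ k e t →
  (∃ λ i → i < t × σ (i + e) ≤ k) ⊎ (t * suc k ≤ τ (t + e))
small-increment-or-growth σ τ grows k e zero    = inj₂ z≤n
small-increment-or-growth σ τ grows k e (suc t) with σ (t + e) ≤? k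
... | yes small = inj₁ (t , ℕ.≤-refl , small)
... | no  large with small-increment-or-growth σ τ grows k e t
...   | inj₁ (i , i<t , small) = inj₁ (i , ℕ.m≤n⇒m≤1+n i<t , small)
...   | inj₂ many = inj₂ (ℕ.≤-trans (ℕ.+-mono-≤ (ℕ.≰⇒> large) many) (grows (t + e)))

small-increment : (σ τ : ℕ → ℕ) → (∀ i → σ i + τ i ≤ τ (suc i)) → ∀ {N} → (∀ i → τ i ≤ N) →
  ∀ k e {t} → N < t * suc k → ∃ λ i → i < t × σ (i + e) ≤ k
small-increment σ τ grows τ≤N k e {t} N<tk with small-increment-or-growth σ τ grows k e t
... | inj₁ found = found
... | inj₂ many  = contradiction (ℕ.≤-trans many (τ≤N (t + e))) (ℕ.<⇒≱ N<tk)

-- The factor 4 leaves room for induction: `s` grows only when s² ≤ n, and then (s + 1)² ≤ 4(s² + 1)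
-- ≤ 4(n + 1).
sqrt-approx : ∀ n → ∃ λ s → n ≤ s * s × s * s ≤ 4 * n
sqrt-approx zero    = 0 , z≤n , z≤n
sqrt-approx (suc n) with sqrt-approx n
... | s , n≤s² , s²≤4n with suc n ≤? s * s
...   | yes 1+n≤s² = s , 1+n≤s² , ℕ.≤-trans s²≤4n (ℕ.*-monoʳ-≤ 4 (ℕ.n≤1+n n))
...   | no  1+n≰s² = suc s , ℕ.≤-trans (s≤s n≤s²) (square-suc s) , upper
  where
  square-suc : ∀ s → suc (s * s) ≤ suc s * suc s
  square-suc s = s≤s (ℕ.≤-trans (ℕ.*-monoʳ-≤ s (ℕ.n≤1+n s)) (ℕ.m≤n+m (s * suc s) s))
  s²≤n : s * s ≤ n
  s²≤n = ℕ.≤-pred (ℕ.≰⇒> 1+n≰s²)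
  square-suc≤ : ∀ s → suc s * suc s ≤ 4 * suc (s * s)
  square-suc≤ zero    = s≤s z≤n
  square-suc≤ (suc s) = ℕ.≤-trans (ℕ.m≤m+n _ (3 * (s * s) + 4 * s + 4)) (ℕ.≤-reflexive (expand s))
    where
    expand : ∀ s → suc (suc s) * suc (suc s) + (3 * (s * s) + 4 * s + 4) ≡ 4 * suc (suc s * suc s)
    expand = solve-∀
  upper : suc s * suc s ≤ 4 * suc n
  upper = ℕ.≤-trans (square-suc≤ s) (ℕ.*-monoʳ-≤ 4 (s≤s s²≤n))

-- The greedy chain of an interval representation

≤ℚ⊎> : ∀ x y → x ≤ℚ y ⊎ y <ℚ x
≤ℚ⊎> x y with x ℚ.≤? y
... | yes x≤y = inj₁ x≤y
... | no  x≰y = inj₂ (ℚ.≰⇒> x≰y)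

module IntervalModel {n} (G : Graph (suc n)) (connected : Connected G)
  (a b : Fin (suc n) → ℚ) (a≤b : ∀ v → a v ≤ℚ b v)
  (model : (u v : Fin (suc n)) → ¬ (u ≡ v) →
       (Adj G u v → ∃ λ x → (a u ≤ℚ x × x ≤ℚ b u) × (a v ≤ℚ x × x ≤ℚ b v)) ×
       ((∃ λ x → (a u ≤ℚ x × x ≤ℚ b u) × (a v ≤ℚ x × x ≤ℚ b v)) → Adj G u v))
  where

  adj⇒a≤b : ∀ {u w} → Adj G u w → a u ≤ℚ b w
  adj⇒a≤b {u} {w} u~w with u ≟ w
  ... | yes refl = contradiction u~w (irrefl G)
  ... | no  u≢w with proj₁ (model u w u≢w) u~w
  ...   | x , (au≤x , _) , (_ , x≤bw) = ℚ.≤-trans au≤x x≤bw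

  contains-left⇒touches : ∀ {u r} → a u ≤ℚ a r → a r ≤ℚ b u → Touches G u r
  contains-left⇒touches {u} {r} au≤ar ar≤bu with u ≟ r
  ... | yes u≡r = inj₁ u≡r
  ... | no  u≢r = inj₂ (proj₂ (model u r u≢r) (a r , (au≤ar , ar≤bu) , (ℚ.≤-refl , a≤b r)))

  vertices : List (Fin (suc n))
  vertices = allFin (suc n)

  leftmost : Fin (suc n)
  leftmost = argmin a zero vertices

  leftmost-min : ∀ v → a leftmost ≤ℚ a v
  leftmost-min v = All.lookup (f[argmin]≤f[xs] {f = a} zero vertices) (∈-allFin v)

  startedBy : ℚ → List (Fin (suc n))
  startedBy x = filter (λ v → a v ℚ.≤? x) vertices

  furthest : ℚ → Fin (suc n)
  furthest x = argmax b leftmost (startedBy x)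

  -- The default `leftmost` of the `argmax` also starts by `x`, so the maximiser does in either
  -- case.
  furthest-started : ∀ {x} → a leftmost ≤ℚ x → a (furthest x) ≤ℚ x
  furthest-started {x} le = argmax-all b {P = λ v → a v ≤ℚ x} le (all-filter (λ v → a v ℚ.≤? x) vertices)

  furthest-max : ∀ {x} v → a v ≤ℚ x → b v ≤ℚ b (furthest x)
  furthest-max {x} v av≤x =
    All.lookup (f[xs]≤f[argmax] {f = b} leftmost (startedBy x)) (∈-filter⁺ (λ v → a v ℚ.≤? x) (∈-allFin v) av≤x)

  p : ℕ → ℚ
  p zero    = a leftmost
  p (suc i) = b (furthest (p i))

  chain : ℕ → Fin (suc n)
  chain i = furthest (p i)

  leftmost≤p : ∀ i → a leftmost ≤ℚ p i
  leftmost≤p zero    = ℚ.≤-refl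
  leftmost≤p (suc i) = ℚ.≤-trans (leftmost-min (chain i)) (a≤b (chain i))

  p-step : ∀ i → p i ≤ℚ p (suc i)
  p-step zero    = ℚ.≤-trans (a≤b leftmost) (furthest-max leftmost ℚ.≤-refl)
  p-step (suc i) = furthest-max (chain i) (a≤b (chain i))

  p-mono : ∀ d i → p i ≤ℚ p (d + i)
  p-mono zero    i = ℚ.≤-refl
  p-mono (suc d) i = ℚ.≤-trans (p-mono d i) (p-step (d + i))

  chain-touches : ∀ i {r} → p i ≤ℚ a r → a r ≤ℚ p (suc i) → Touches G (chain i) r
  chain-touches i pi≤ar = contains-left⇒touches (ℚ.≤-trans (furthest-started (leftmost≤p i)) pi≤ar)

  chainFrom : ℕ → ℕ → List (Fin (suc n))
  chainFrom zero    e = chain e ∷ []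
  chainFrom (suc t) e = chain e ∷ chainFrom t (suc e)

  length-chainFrom : ∀ t e → length (chainFrom t e) ≡ suc t
  length-chainFrom zero    e = refl
  length-chainFrom (suc t) e = cong suc (length-chainFrom t (suc e))

  -- The interval of `chain i` contains everything from `p i` to `p (suc i)`, so `t + 1` consecutive
  -- ones leave no gap.
  chainFrom-touches : ∀ t e {r} → p e ≤ℚ a r → a r ≤ℚ p (t + suc e) →
    Any (λ u → Touches G u r) (chainFrom t e)
  chainFrom-touches zero    e     lo hi = here (chain-touches e lo hi)
  chainFrom-touches (suc t) e {r} lo hi with ≤ℚ⊎> (a r) (p (suc e))
  ... | inj₁ ar≤p = here (chain-touches e lo ar≤p)
  ... | inj₂ ar>p = there (chainFrom-touches t (suc e) (ℚ.<⇒≤ ar>p)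
                     (subst (λ i → a r ≤ℚ p i) (≡-sym (ℕ.+-suc t (suc e))) hi))

  Cut Passed : ℕ → Fin (suc n) → Set
  Cut    i v = a v ≤ℚ p i × p i <ℚ b v
  Passed i v = b v ≤ℚ p i

  cut? : ∀ i → Decidable (Cut i)
  cut? i v = (a v ℚ.≤? p i) ×-dec (p i ℚ.<? b v)

  passed? : ∀ i → Decidable (Passed i)
  passed? i v = b v ℚ.≤? p i

  cutList passedList : ℕ → List (Fin (suc n))
  cutList    i = filter (cut? i) vertices
  passedList i = filter (passed? i) vertices

  -- Disjointness of the cuts as a count: a vertex of cut `i` is passed at `suc i` by maximality of
  -- `chain i`, but not at `i` by the strict inequality in `Cut`.
  cut+passed≤passed : ∀ i → length (cutList i) + length (passedList i) ≤ length (passedList (suc i))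
  cut+passed≤passed i = length-filter-disjoint (cut? i) (passed? i) (passed? (suc i))
    (λ {v} cut → furthest-max v (proj₁ cut))
    (λ passed → ℚ.≤-trans passed (p-step i))
    (λ cut passed → ℚ.<-irrefl refl (ℚ.<-≤-trans (proj₂ cut) passed))
    vertices

  passed≤n : ∀ i → length (passedList i) ≤ suc n
  passed≤n i = ℕ.≤-trans (length-filter (passed? i) vertices) (ℕ.≤-reflexive (length-tabulate (λ v → v)))

  abstract
    small-cut : ∀ k e t → suc n < t * suc k → ∃ λ i → i < t × length (cutList (i + e)) ≤ k
    small-cut k e t = small-increment (length ∘ cutList) (length ∘ passedList) cut+passed≤passed passed≤n k e {t}

  -- A neighbour starting by `p i` must reach `a u`, beyond `p i`, and so lies in the cut.
  cut-separates : ∀ i {u w} → p i <ℚ a u → Adj G u w → ¬ Cut i w → p i <ℚ a w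
  cut-separates i {u} {w} pi<au u~w w∉cut with ≤ℚ⊎> (a w) (p i)
  ... | inj₁ aw≤pi = contradiction (aw≤pi , ℚ.<-≤-trans pi<au (adj⇒a≤b u~w)) w∉cut
  ... | inj₂ aw>pi = aw>pi

  -- The last vertex of the walk with left endpoint at most `p i` meets an interval that begins
  -- after `p i`.
  walk-crosses-cut : ∀ i {v r} → Walk G v r → a v ≤ℚ p i → p i <ℚ a r → ∃ (Cut i)
  walk-crosses-cut i here av≤pi pi<ar = contradiction (ℚ.<-≤-trans pi<ar av≤pi) (ℚ.<-irrefl refl)
  walk-crosses-cut i (step {v = w} walk w~r) av≤pi pi<ar with ≤ℚ⊎> (a w) (p i)
  ... | inj₁ aw≤pi = w , aw≤pi , ℚ.<-≤-trans pi<ar (adj⇒a≤b (sym G w~r))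
  ... | inj₂ aw>pi = walk-crosses-cut i walk av≤pi aw>pi

  empty-cut-ends : ∀ i → length (cutList i) ≤ 0 → ∀ r → ¬ (p i <ℚ a r)
  empty-cut-ends i empty r pi<ar = ℕ.<⇒≱ (filter-some (cut? i) (lose (∈-allFin w) w∈cut)) empty
    where
    crossing = walk-crosses-cut i (connected leftmost r) (leftmost≤p i) pi<ar
    w        = proj₁ crossing
    w∈cut    = proj₂ crossing

  chain-ends : ∃ λ i → ∀ r → ¬ (p i <ℚ a r)
  chain-ends = i + 0 , empty-cut-ends (i + 0) (proj₂ (proj₂ emptyCut))
    where
    -- The first `2 + n` cuts are disjoint and there are only `suc n` vertices, so one cut is empty.
    emptyCut = small-cut 0 0 (2 + n) (ℕ.≤-reflexive (≡-sym (ℕ.*-identityʳ (2 + n))))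
    i        = proj₁ emptyCut

  -- Blocks between consecutive small cuts, and the resulting bound

  module Blocks (s : ℕ) (n<s[1+s] : suc n < s * suc s) where

    gap : ℕ → ℕ
    -- The search begins at `suc e`, so each stage advances by at least one cut.
    gap e = proj₁ (small-cut s (suc e) s n<s[1+s])

    nextCut : ℕ → ℕ
    nextCut e = gap e + suc e

    cutIndex : ℕ → ℕ
    cutIndex zero    = 0
    cutIndex (suc j) = nextCut (cutIndex j)

    j≤cutIndex : ∀ j → j ≤ cutIndex j
    j≤cutIndex zero    = z≤n
    j≤cutIndex (suc j) = ℕ.≤-trans (s≤s (j≤cutIndex j)) (ℕ.m≤n+m (suc (cutIndex j)) (gap (cutIndex j)))

    block : ℕ → List (Fin (suc n))
    block e = chainFrom (gap e) e ++ cutList (nextCut e)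

    -- There are `gap e + 1` chain vertices, at most `s` because `gap e < s`; the small cut adds at
    -- most `s` more.
    length-block : ∀ e → length (block e) ≤ s + s
    length-block e = ℕ.≤-trans (ℕ.≤-reflexive (length-++ (chainFrom (gap e) e)))
      (ℕ.+-mono-≤ (ℕ.≤-trans (ℕ.≤-reflexive (length-chainFrom (gap e) e)) gap<s) small)
      where
      gap<s = proj₁ (proj₂ (small-cut s (suc e) s n<s[1+s]))
      small = proj₂ (proj₂ (small-cut s (suc e) s n<s[1+s]))

    X : ℕ → Fin (s + s) → Fin (suc n)
    X j = pad (s + s) zero (block (cutIndex j))

    block⇒X : ∀ {P : Fin (suc n) → Set} j → Any P (block (cutIndex j)) → ∃ λ i → P (X j i)
    block⇒X j = pad-any (s + s) zero (length-block (cutIndex j))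

    -- Block `j` ends with the cut of index `cutIndex (suc j)`, hence the shift.
    R : ℕ → Fin (suc n) → Set
    R j v = p (cutIndex (suc j)) <ℚ a v

    barrier : ∀ j {u w} → R j u → Adj G u w → ¬ Occupied (X j) w → R j w
    barrier j {w = w} Ru u~w free = cut-separates (cutIndex (suc j)) Ru u~w λ w∈cut →
      free (block⇒X j (++⁺ʳ (chainFrom (gap e) e)
        (Any.map ≡-sym (∈-filter⁺ (cut? (cutIndex (suc j))) (∈-allFin w) w∈cut))))
      where e = cutIndex j

    touched-or-beyond : ∀ j {r} → p (cutIndex j) ≤ℚ a r → (∃ λ i → Touches G (X j i) r) ⊎ R j r
    touched-or-beyond j {r} lo = map₁
      (λ hi → block⇒X j (++⁺ˡ (chainFrom-touches (gap (cutIndex j)) (cutIndex j) lo hi)))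
      (≤ℚ⊎> (a r) (p (cutIndex (suc j))))

    R-ends : ∃ λ m → ∀ r → ¬ R m r
    R-ends = i , λ r Rr → proj₂ chain-ends r (ℚ.≤-<-trans p≤ Rr)
      where
      i = proj₁ chain-ends
      i≤ : i ≤ cutIndex (suc i)
      i≤ = ℕ.≤-trans (ℕ.n≤1+n i) (j≤cutIndex (suc i))
      p≤ : p i ≤ℚ p (cutIndex (suc i))
      p≤ = subst (λ k → p i ≤ℚ p k) (ℕ.m∸n+n≡m i≤) (p-mono (cutIndex (suc i) ∸ i) i)

    cops-win : CopWin G (2 * (s + s))
    cops-win = Sweep.sweep G connected X R barrier
      (λ j Rr → touched-or-beyond (suc j) (ℚ.<⇒≤ Rr))
      -- `p 0` is the least left endpoint, so stage 0 covers every first choice of the robber.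
      (λ r → touched-or-beyond 0 (leftmost-min r)) R-ends

-- The inequality is k ≤ C√n squared; any winning `k` bounds the cop number from above.
theorem2p9 : Σ ℕ λ C → (n : ℕ) → (G : Graph n) → Connected G → IsInterval G →
    ∃ λ k → CopWin G k × k * k ≤ C * C * n
theorem2p9 = 8 , bound
  where
  bound : ∀ n (G : Graph n) → Connected G → IsInterval G → ∃ λ k → CopWin G k × k * k ≤ 8 * 8 * n
  bound zero    G connected _ = 0 , ((λ ()) , λ ()) , z≤n
  bound (suc n) G connected (a , b , a≤b , model) with sqrt-approx (suc n)
  -- The root is positive, since 0 would give `suc n ≤ 0`.
  ... | suc s , n≤s² , s²≤4n = 2 * (suc s + suc s) , cops-win , count
    where
    n<s[1+s] : suc n < suc s * suc (suc s)
    n<s[1+s] = ℕ.≤-<-trans n≤s² (ℕ.*-monoʳ-< (suc s) (ℕ.n<1+n (suc s)))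
    open IntervalModel.Blocks G connected a b a≤b model (suc s) n<s[1+s] using (cops-win)
    square : ∀ s → 2 * (s + s) * (2 * (s + s)) ≡ 16 * (s * s)
    square = solve-∀
    -- With root s there are 4s cops, and 16s² ≤ 16 · 4n = 8²n yields the constant 8.
    count : 2 * (suc s + suc s) * (2 * (suc s + suc s)) ≤ 8 * 8 * suc n
    count = subst₂ _≤_ (≡-sym (square (suc s))) (≡-sym (ℕ.*-assoc 16 4 (suc n))) (ℕ.*-monoʳ-≤ 16 s²≤4n)
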